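{- There is an absolute constant $C>0$ such that for every integer $k \ge 1$ with $\sqrt{k}\in\mathbb{N}$, we have \[ c_{G_k} \le 2^{C\sqrt{k}\log^2 k}. \]
   Context: For $k$ a perfect square, $G_k$ is the $k\times k$ binary matrix whose $1$-entries are exactly at the positions $(a+b\sqrt{k}+1,\ b+a\sqrt{k}+1)$ for all $a,b\in\{0,\dots,\sqrt{k}-1\}$ (a permutation matrix). A binary matrix $A$ contains a binary matrix $B$ if $B$ can be obtained from $A$ by deleting some rows, some columns, and changing some $1$-entries to $0$-entries; otherwise $A$ avoids $B$. $\mathrm{ex}(n,B)$ is the maximum number of $1$-entries in an $n\times n$ binary matrix avoiding $B$. For a permutation matrix $P$, $c_P=\lim_{n\to\infty}\mathrm{ex}(n,P)/n$ (this limit exists and is finite). Logarithms are base $2$. -}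

module Defs where

open import Data.Nat using (ℕ; zero; suc; _+_; _*_; _<_; _≤_)
open import Data.Nat.DivMod using (_/_; _%_)
open import Data.Fin using (Fin; toℕ)
open import Data.Bool using (Bool; true; false; if_then_else_)
open import Data.List using (map)
open import Data.Nat.ListAction using (sum)
open import Data.List.Base using ()
open import Data.Fin.Base using ()
open import Data.List using (List)
open import Data.Fin.Base using () renaming (_<_ to _<ᶠ_)
open import Data.Product using (Σ; _×_)
open import Relation.Binary.PropositionalEquality using (_≡_)
open import Relation.Nullary using (¬_)
open import Relation.Nullary.Decidable using (⌊_⌋)
open import Data.Nat using (_≟_)
open import Data.List using (allFin)

Mat : ℕ → ℕ → Set
Mat m n = Fin m → Fin n → Bool

ones : ∀ {m n} → Mat m n → ℕ
ones {m} {n} A = sum (map (λ i → sum (map (λ j → if A i j then 1 else 0) (allFin n))) (allFin m))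

StrictlyIncreasing : ∀ {k n} → (Fin k → Fin n) → Set
StrictlyIncreasing f = ∀ i j → i <ᶠ j → f i <ᶠ f j

-- A contains B: B is obtained from A by deleting rows/columns and turning 1s into 0s,
-- i.e. there are increasing row/column embeddings under which every 1 of B sits on a 1 of A
Contains : ∀ {m n p q} → Mat m n → Mat p q → Set
Contains {m} {n} {p} {q} A B =
  Σ (Fin p → Fin m) λ f → Σ (Fin q → Fin n) λ g →
    StrictlyIncreasing f × StrictlyIncreasing g ×
    (∀ i j → B i j ≡ true → A (f i) (g j) ≡ true)

Avoids : ∀ {m n p q} → Mat m n → Mat p q → Set
Avoids A B = ¬ Contains A B

-- G_k for k = s*s (0-indexed): entry (r , c) is 1 iff r = a + b s and c = b + a s
-- for some a, b < s; equivalently c = (r / s) + (r % s) * s.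
G : (s : ℕ) → Mat (s * s) (s * s)
G zero () c
G (suc t) r c = ⌊ toℕ c ≟ (toℕ r / suc t) + (toℕ r % suc t) * suc t ⌋

-- The bound comes from the Marcus–Tardos contraction with t × t blocks, where t = 2^(5L) and
-- L = ⌈log₂ s²⌉. Call a block wide if more than w = s 2^L of its columns are nonempty, and tall if
-- its transpose is wide. The other blocks carry at most w² < t ones each, and contracting
-- blocks to single entries preserves avoidance, so a linear bound follows by induction
-- once each column of blocks contains at most W = 2^O(s L²) wide blocks.
--
-- A column of blocks gives rows, one per block, on t columns. If many of them have more than
-- s 2^r ones, the pigeonhole principle at cost t^(s+1) cuts the columns into s places in each of
-- which every remaining row has at least 2^r ones. A further pigeonhole at cost t^s makes the rows agree
-- on the median of their ones in each place; the upper half of the rows then continues in the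
-- left parts and the lower half in the right parts. After r rounds there are 2^r ≥ s
-- batches of s rows, each batch meeting every place further right than the one before, and this is
-- exactly the pattern G.
module Submission where

open import Defs
open import Algebra.Properties.CommutativeSemigroup using (interchange)
open import Data.Bool using (Bool; true; false; T; if_then_else_)
open import Data.Bool.Properties using (T-≡)
open import Data.Empty using (⊥-elim)
open import Data.Fin using (Fin; toℕ; fromℕ<; inject₁; inject≤; combine; remQuot)
  renaming (zero to fzero; suc to fsuc; _<_ to _<ᶠ_)
open import Data.Fin.Properties using (toℕ<n; toℕ-inject₁; toℕ-inject≤; toℕ-injective; toℕ-fromℕ<;
  fromℕ<-toℕ; fromℕ<-cong; toℕ-combine; remQuot-combine; combine-remQuot; combine-monoˡ-<)
  renaming (<-cmp to <ᶠ-cmp)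
open import Data.List using (List; []; _∷_; [_]; _++_; length; lookup; take; drop; map; tabulate; allFin)
open import Data.List.Membership.Propositional using (_∈_)
open import Data.List.Membership.Propositional.Properties using (∈-lookup)
open import Data.List.Properties using (length-++; length-take; length-drop; map-tabulate; map-cong)
open import Data.List.Relation.Binary.Sublist.Propositional
  using (_⊆_; []; _∷_; _∷ʳ_; ⊆-refl; ⊆-trans)
  renaming (lookup to ⊆-lookup)
open import Data.List.Relation.Binary.Sublist.Propositional.Properties using (All-resp-⊆; take-⊆; drop-⊆)
open import Data.List.Relation.Unary.All as All using (All; []; _∷_)
open import Data.List.Relation.Unary.All.Properties as AllP using ()
open import Data.List.Relation.Unary.AllPairs using (AllPairs; []; _∷_)
open import Data.List.Relation.Unary.AllPairs.Properties as AllPairsP using ()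
open import Data.Nat
open import Data.Nat.DivMod using (m≡m%n+[m/n]*n; m<n*o⇒m/o<n; m%n<n)
open import Data.Nat.Induction using (<-rec)
open import Data.Nat.Logarithm using (⌈log₂_⌉; ⌈log₂⌉-mono-≤; ⌈log₂⌈n/2⌉⌉≡⌈log₂n⌉∸1)
open import Data.Nat.ListAction using (sum)
open import Data.Nat.Properties
open import Data.Nat.Solver using (module +-*-Solver)
open import Data.Product using (Σ; ∃; ∃₂; _×_; _,_; proj₁; proj₂; uncurry)
open import Data.Sum using (_⊎_; inj₁; inj₂)
open import Data.Unit using (tt)
open import Function using (_∘_; flip; case_of_; Equivalence)
open import Relation.Binary.Definitions using (tri<; tri≈; tri>)
open import Relation.Binary.PropositionalEquality
  using (_≡_; refl; sym; trans; cong; cong₂; subst; subst₂; module ≡-Reasoning)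
open import Relation.Nullary using (¬_; yes; no)
open import Relation.Nullary.Decidable using (⌊_⌋; T?; toWitness; fromWitness)

open +-*-Solver using (solve; _:=_; _:+_; _:*_; con)

private variable
  X : Set
  s : ℕ

-- Sums and counts over initial segments.

∑ : ℕ → (ℕ → ℕ) → ℕ
∑ zero    f = 0
∑ (suc n) f = ∑ n f + f n

⟦_⟧ : Bool → ℕ
⟦ b ⟧ = if b then 1 else 0

count : (ℕ → Bool) → ℕ → ℕ
count p n = ∑ n (λ i → ⟦ p i ⟧)

∑-monoˡ-≤ : ∀ f {m n} → m ≤ n → ∑ m f ≤ ∑ n f
∑-monoˡ-≤ f {n = zero}  z≤n = z≤n
∑-monoˡ-≤ f {n = suc n} m≤n with m≤n⇒m<n∨m≡n m≤n
... | inj₁ (s≤s m≤n) = ≤-trans (∑-monoˡ-≤ f m≤n) (m≤m+n _ _)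
... | inj₂ refl      = ≤-refl

⟦T⟧≡1 : ∀ b → T b → ⟦ b ⟧ ≡ 1
⟦T⟧≡1 true _ = refl

-- A hit at `n` makes the count jump there, so any `m` beyond `n` has a strictly larger count.
-- Positions are compared through their counts in this way.
count-reflects-≤ : ∀ p {m n} → T (p n) → count p m ≤ count p n → m ≤ n
count-reflects-≤ p {m} {n} pn le = ≮⇒≥ λ n<m → <⇒≱
  (subst (_≤ count p m)
    (trans (cong (count p n +_) (⟦T⟧≡1 (p n) pn)) (+-comm (count p n) 1))
    (∑-monoˡ-≤ _ n<m))
  le

-- Hits are numbered from 0: `c` is the hit with exactly `v` hits before it.
nth-hit : ∀ p v n → v < count p n → ∃ λ c → c < n × T (p c) × count p c ≡ v
nth-hit p v (suc n) v< with v <? count p n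
... | yes v<n = let c , c<n , rest = nth-hit p v n v<n in c , m<n⇒m<1+n c<n , rest
... | no v≮n  with p n in eq
...   | true  = n , ≤-refl , subst T (sym eq) tt
              , ≤-antisym (≮⇒≥ v≮n) (≤-pred (subst (v <_) (+-comm (count p n) 1) v<))
...   | false = ⊥-elim (v≮n (subst (v <_) (+-identityʳ _) v<))

-- Ordered lists and their sublists.

AllPairs-resp-⊆ : ∀ {R : X → X → Set} {xs ys} → xs ⊆ ys → AllPairs R ys → AllPairs R xs
AllPairs-resp-⊆ []         []         = []
AllPairs-resp-⊆ (_ ∷ʳ τ)   (_  ∷ rys) = AllPairs-resp-⊆ τ rys
AllPairs-resp-⊆ (refl ∷ τ) (ry ∷ rys) = All-resp-⊆ τ ry ∷ AllPairs-resp-⊆ τ rys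

AllPairs-lookup : ∀ {R : X → X → Set} {xs} → AllPairs R xs →
  ∀ {i j} → i <ᶠ j → R (lookup xs i) (lookup xs j)
AllPairs-lookup (rx ∷ _)  {fzero}  {fsuc j} _         = All.lookup rx (∈-lookup j)
AllPairs-lookup (_ ∷ rxs) {fsuc i} {fsuc j} (s≤s i<j) = AllPairs-lookup rxs i<j

AllPairs-take-drop : ∀ {R : X → X → Set} k {xs} → AllPairs R xs →
  ∀ {u v} → u ∈ take k xs → v ∈ drop k xs → R u v
AllPairs-take-drop k rxs u∈ v∈ = All.lookup (All.lookup (cross k rxs) u∈) v∈
  where
  cross : ∀ {R : X → X → Set} k {xs} → AllPairs R xs →
    All (λ u → All (R u) (drop k xs)) (take k xs)
  cross zero    _          = []
  cross (suc k) []         = []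
  cross (suc k) (rx ∷ rxs) = AllP.drop⁺ k rx ∷ cross k rxs

-- Pigeonhole principles for lists

separate : ∀ {P Q : X → Set} {xs} → All (λ x → P x ⊎ Q x) xs →
  ∃₂ λ ys zs → ys ⊆ xs × zs ⊆ xs × All P ys × All Q zs × length xs ≡ length ys + length zs
separate [] = [] , [] , [] , [] , [] , [] , refl
separate (px ∷ pxs) with separate pxs
separate (inj₁ p ∷ pxs) | ys , zs , ys⊆ , zs⊆ , pys , qzs , eq =
  _ ∷ ys , zs , refl ∷ ys⊆ , _ ∷ʳ zs⊆ , p ∷ pys , qzs , cong suc eq
separate (inj₂ q ∷ pxs) | ys , zs , ys⊆ , zs⊆ , pys , qzs , eq =
  ys , _ ∷ zs , _ ∷ʳ ys⊆ , refl ∷ zs⊆ , pys , q ∷ qzs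
  , trans (cong suc eq) (sym (+-suc (length ys) (length zs)))

-- Colours are peeled off one at a time: the class of the last colour is weighed against the best
-- class among the others, and the longer is kept. The product form of the bound avoids division.
pigeonhole : ∀ q {P : X → ℕ → Set} xs → All (λ x → ∃ λ c → c < q × P x c) xs →
  ∃₂ λ c ys → ys ⊆ xs × All (λ y → P y c) ys × length xs ≤ q * length ys
pigeonhole zero    []      _                   = 0 , [] , [] , [] , z≤n
pigeonhole zero    (_ ∷ _) ((_ , () , _) ∷ _)
pigeonhole (suc q) {P} xs  all with separate (All.map last-or-earlier all)
  where
  last-or-earlier : ∀ {x} → (∃ λ c → c < suc q × P x c) → P x q ⊎ (∃ λ c → c < q × P x c)
  last-or-earlier (c , c<1+q , pxc) with m<1+n⇒m<n∨m≡n c<1+q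
  ... | inj₁ c<q  = inj₂ (c , c<q , pxc)
  ... | inj₂ refl = inj₁ pxc
... | ys , zs , ys⊆ , zs⊆ , pys , pzs , eq with pigeonhole q zs pzs
... | c , ws , ws⊆ , pws , le with ≤-total (length ys) (length ws)
... | inj₁ ys≤ws = c , ws , ⊆-trans ws⊆ zs⊆ , pws
                 , subst (_≤ suc q * length ws) (sym eq) (+-mono-≤ ys≤ws le)
... | inj₂ ws≤ys = q , ys , ys⊆ , pys
                 , subst (_≤ suc q * length ys) (sym eq)
                     (+-monoʳ-≤ (length ys) (≤-trans le (*-monoʳ-≤ q ws≤ys)))

-- The `k` colourings are handled one after another, each at the cost of a factor `q`.
pigeonholes : ∀ k q {P : Fin k → X → ℕ → Set} xs →
  All (λ x → ∀ a → ∃ λ c → c < q × P a x c) xs →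
  Σ (Fin k → ℕ) λ c → ∃ λ ys →
    ys ⊆ xs × All (λ y → ∀ a → P a y (c a)) ys × length xs ≤ q ^ k * length ys
pigeonholes zero    q xs _   = (λ ()) , xs , ⊆-refl , All.universal (λ _ ()) xs , ≤-reflexive (sym (*-identityˡ (length xs)))
pigeonholes {X} (suc k) q {P} xs all
  with pigeonhole q xs (All.map (λ f → f fzero) all)
... | c₀ , ys , ys⊆ , pys , leys
  with pigeonholes k q ys (All.map (λ f a → f (fsuc a)) (All-resp-⊆ ys⊆ all))
... | c , zs , zs⊆ , pzs , lezs = c′ , zs , ⊆-trans zs⊆ ys⊆
    , All.zipWith (λ (p₀ , p) → λ { fzero → p₀ ; (fsuc a) → p a }) (All-resp-⊆ zs⊆ pys , pzs)
    , (begin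
        length xs                     ≤⟨ leys ⟩
        q * length ys                 ≤⟨ *-monoʳ-≤ q lezs ⟩
        q * (q ^ k * length zs)       ≡⟨ *-assoc q (q ^ k) (length zs) ⟨
        q ^ suc k * length zs         ∎)
  where
  open ≤-Reasoning
  c′ : Fin (suc k) → ℕ
  c′ fzero    = c₀
  c′ (fsuc a) = c a

-- Grid patterns in matrices with dense rows

-- The pattern G of order s with its row b * s + a indexed by (b , a) and its column a * s + b by (a , b).
record Grid (s : ℕ) (A : ℕ → ℕ → Bool) : Set where
  field
    row col : Fin s → Fin s → ℕ
    row-inner : ∀ b {a a′} → a <ᶠ a′ → row b a < row b a′
    row-outer : ∀ {b b′} → b <ᶠ b′ → ∀ a a′ → row b a < row b′ a′
    col-inner : ∀ a {b b′} → b <ᶠ b′ → col a b < col a b′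
    col-outer : ∀ {a a′} → a <ᶠ a′ → ∀ b b′ → col a b < col a′ b′
    hit       : ∀ b a → T (A (row b a) (col a b))

open Grid

-- The s consecutive rows of a grid with the same b, and their columns, one in each place.
record Batch (s : ℕ) : Set where
  constructor batch
  field
    brow bcol : Fin s → ℕ

open Batch

-- Rows are compared across all places, columns only within the same place; columns in different
-- places are ordered by the places themselves.
_≺_ : Batch s → Batch s → Set
β ≺ γ = (∀ a a′ → brow β a < brow γ a′) × (∀ a → bcol β a < bcol γ a)

module _ {s : ℕ} (A : ℕ → ℕ → Bool) (t : ℕ) .{{_ : NonZero t}} where

  -- The places are the half-open intervals from `lo a` to `hi a`.
  record Valid (xs : List ℕ) (lo hi : Fin s → ℕ) (β : Batch s) : Set where
    field
      row∈ : ∀ a → brow β a ∈ xs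
      row< : ∀ {a a′} → a <ᶠ a′ → brow β a < brow β a′
      lo≤  : ∀ a → lo a ≤ bcol β a
      <hi  : ∀ a → bcol β a < hi a
      hits : ∀ a → T (A (brow β a) (bcol β a))

  open Valid

  -- Additive, to avoid truncated subtraction; `hi a ≤ t` makes every median a colour below `t` for
  -- the pigeonhole.
  Dense : (lo hi : Fin s → ℕ) → ℕ → ℕ → Set
  Dense lo hi v x = ∀ a → hi a ≤ t × count (A x) (lo a) + v ≤ count (A x) (hi a)

  -- The ones are taken diagonally: the `a`-th row supplies the one in place `a`.
  single-batch : ∀ {lo hi} xs → AllPairs _<_ xs → All (Dense lo hi 1) xs → s ≤ length xs →
    ∃ (Valid xs lo hi)
  single-batch {lo} {hi} xs inc dense s≤ = batch x (proj₁ ∘ pick) , record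
    { row∈ = λ a → ∈-lookup (inject≤ a s≤)
    ; row< = λ {a} {a′} a<a′ → AllPairs-lookup inc
        (subst₂ _<_ (sym (toℕ-inject≤ a s≤)) (sym (toℕ-inject≤ a′ s≤)) a<a′)
    ; lo≤  = λ a → let c , _ , h , e = pick a in
        count-reflects-≤ (A (x a)) h (≤-reflexive (sym e))
    ; <hi  = λ a → proj₁ (proj₂ (pick a))
    ; hits = λ a → proj₁ (proj₂ (proj₂ (pick a)))
    }
    where
    x : Fin s → ℕ
    x a = lookup xs (inject≤ a s≤)
    -- The hit whose number is the count at `lo a` is the first one at or after `lo a`.
    pick : ∀ a → ∃ λ c → c < hi a × T (A (x a) c) × count (A (x a)) c ≡ count (A (x a)) (lo a)
    pick a = nth-hit (A (x a)) _ (hi a)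
      (subst (_≤ count (A (x a)) (hi a)) (+-comm _ 1)
        (proj₂ (All.lookup dense (∈-lookup (inject≤ a s≤)) a)))

  record Median (l h r x c : ℕ) : Set where
    field
      c<h    : c < h
      l≤c    : l ≤ c
      h≤t    : h ≤ t
      left   : count (A x) l + 2 ^ r ≤ count (A x) c
      right  : count (A x) c + 2 ^ r ≤ count (A x) h

  open Median

  -- The hit `c` numbered `2 ^ r` from `l` has `2 ^ r` hits before it, and at least `2 ^ r` remain
  -- from `c` on, `c` included.
  median : ∀ r {l h x} → h ≤ t → count (A x) l + 2 ^ suc r ≤ count (A x) h →
    ∃ λ c → c < t × Median l h r x c
  median r {l} {h} {x} h≤t le =
    let c , c<h , hc , e = nth-hit (A x) (count (A x) l + 2 ^ r) h
          (<-≤-trans (+-monoʳ-< (count (A x) l) (^-monoʳ-< 2 ≤-refl (n<1+n r))) le)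
    in c , <-≤-trans c<h h≤t , record
      { c<h   = c<h
      ; l≤c   = count-reflects-≤ (A x) hc (≤-trans (m≤m+n _ _) (≤-reflexive (sym e)))
      ; h≤t   = h≤t
      ; left  = ≤-reflexive (sym e)
      ; right = begin
          count (A x) c + 2 ^ r             ≡⟨ cong (_+ 2 ^ r) e ⟩
          count (A x) l + 2 ^ r + 2 ^ r     ≡⟨ +-assoc _ (2 ^ r) (2 ^ r) ⟩
          count (A x) l + (2 ^ r + 2 ^ r)   ≡⟨ cong (λ z → count (A x) l + (2 ^ r + z)) (+-identityʳ (2 ^ r)) ⟨
          count (A x) l + 2 ^ suc r         ≤⟨ le ⟩
          count (A x) h                     ∎
      }
    where open ≤-Reasoning

  -- Each round costs a factor `t ^ s` for agreeing on all `s` medians and a factor 2 for halving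
  -- the rows. Batches from the upper half stay left of the medians and those from the lower half do
  -- not, so the two lists concatenate to a chain for `≺`. The last factor `s` is the size of one
  -- batch.
  batches : ∀ r {lo hi} xs → AllPairs _<_ xs → All (Dense lo hi (2 ^ r)) xs →
    (2 * t ^ s) ^ r * s ≤ length xs →
    ∃ λ βs → length βs ≡ 2 ^ r × AllPairs _≺_ βs × All (Valid xs lo hi) βs
  batches zero xs inc dense long =
    let β , valid = single-batch xs inc dense (subst (_≤ length xs) (*-identityˡ s) long)
    in [ β ] , refl , [] ∷ [] , valid ∷ []
  batches (suc r) {lo} {hi} xs inc dense long
    with pigeonholes s t {λ a x c → Median (lo a) (hi a) r x c} xs
           (All.map (λ d a → median r (proj₁ (d a)) (proj₂ (d a))) dense)
  ... | mid , ys , ys⊆ , med , le = βs ++ γs , lengths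
      , AllPairsP.++⁺ inβ inγ (All.tabulate λ β∈ → All.tabulate λ γ∈ → cross (All.lookup vβ β∈) (All.lookup vγ γ∈))
      , AllP.++⁺ (All.map widenU vβ) (All.map widenD vγ)
    where
    open ≤-Reasoning
    half = (2 * t ^ s) ^ r * s
    incY = AllPairs-resp-⊆ ys⊆ inc
    us = take half ys
    ds = drop half ys
    us⊆ : us ⊆ ys
    us⊆ = take-⊆ half ys
    ds⊆ : ds ⊆ ys
    ds⊆ = drop-⊆ half ys
    instance
      t^s≢0 : NonZero (t ^ s)
      t^s≢0 = m^n≢0 t s
    half+half≤ : half + half ≤ length ys
    half+half≤ = *-cancelˡ-≤ (t ^ s) (begin
      t ^ s * (half + half)               ≡⟨ cong (λ z → t ^ s * (half + z)) (+-identityʳ half) ⟨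
      t ^ s * (2 * half)                  ≡⟨ *-assoc (t ^ s) 2 half ⟨
      t ^ s * 2 * half                    ≡⟨ cong (_* half) (*-comm (t ^ s) 2) ⟩
      2 * t ^ s * half                    ≡⟨ *-assoc (2 * t ^ s) ((2 * t ^ s) ^ r) s ⟨
      (2 * t ^ s) ^ suc r * s             ≤⟨ long ⟩
      length xs                           ≤⟨ le ⟩
      t ^ s * length ys                   ∎)
    half≤us : half ≤ length us
    half≤us = ≤-reflexive (sym (trans (length-take half ys) (m≤n⇒m⊓n≡m (m+n≤o⇒m≤o half half+half≤))))
    half≤ds : half ≤ length ds
    half≤ds = begin
      half                    ≤⟨ m+n≤o⇒m≤o∸n half half+half≤ ⟩
      length ys ∸ half        ≡⟨ length-drop half ys ⟨
      length ds               ∎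
    medU : All (λ x → ∀ a → Median (lo a) (hi a) r x (mid a)) us
    medU = All-resp-⊆ us⊆ med
    medD : All (λ x → ∀ a → Median (lo a) (hi a) r x (mid a)) ds
    medD = All-resp-⊆ ds⊆ med
    upper = batches r {lo} {mid} us (AllPairsP.take⁺ half incY)
      (All.map (λ m a → ≤-trans (<⇒≤ (c<h (m a))) (h≤t (m a)) , left (m a)) medU) half≤us
    lower = batches r {mid} {hi} ds (AllPairsP.drop⁺ half incY)
      (All.map (λ m a → h≤t (m a) , right (m a)) medD) half≤ds
    βs = proj₁ upper
    γs = proj₁ lower
    inβ = proj₁ (proj₂ (proj₂ upper))
    inγ = proj₁ (proj₂ (proj₂ lower))
    vβ : All (Valid us lo mid) βs
    vβ = proj₂ (proj₂ (proj₂ upper))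
    vγ : All (Valid ds mid hi) γs
    vγ = proj₂ (proj₂ (proj₂ lower))
    lengths : length (βs ++ γs) ≡ 2 ^ suc r
    lengths = trans (length-++ βs) (cong₂ _+_ (proj₁ (proj₂ upper))
      (trans (proj₁ (proj₂ lower)) (sym (+-identityʳ (2 ^ r)))))
    cross : ∀ {β γ} → Valid us lo mid β → Valid ds mid hi γ → β ≺ γ
    cross v w = (λ a a′ → AllPairs-take-drop half incY (row∈ v a) (row∈ w a′))
              , (λ a → <-≤-trans (<hi v a) (lo≤ w a))
    widenU : ∀ {β} → Valid us lo mid β → Valid xs lo hi β
    widenU v = record
      { row∈ = λ a → ⊆-lookup (⊆-trans us⊆ ys⊆) (row∈ v a)
      ; row< = row< v
      ; lo≤  = lo≤ v
      -- That `mid a < hi a` is known only through a row, here the batch's own row in place `a`.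
      ; <hi  = λ a → <-trans (<hi v a) (c<h (All.lookup medU (row∈ v a) a))
      ; hits = hits v
      }
    widenD : ∀ {γ} → Valid ds mid hi γ → Valid xs lo hi γ
    widenD v = record
      { row∈ = λ a → ⊆-lookup (⊆-trans ds⊆ ys⊆) (row∈ v a)
      ; row< = row< v
      ; lo≤  = λ a → ≤-trans (l≤c (All.lookup medD (row∈ v a) a)) (lo≤ v a)
      ; <hi  = <hi v
      ; hits = hits v
      }

  -- Separators at the hits numbered `a * 2 ^ r`, for `a` from 0 to `s`, bound `s` places with
  -- `2 ^ r` ones each in all rows that agree on them. Batch `b` then supplies the rows `(b , a)`,
  -- and its one in place `a` supplies the column `(a , b)`.
  dense-rows⇒grid : ∀ r → s ≤ 2 ^ r → ∀ xs → AllPairs _<_ xs →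
    All (λ x → s * 2 ^ r < count (A x) t) xs →
    t ^ suc s * ((2 * t ^ s) ^ r * s) ≤ length xs → Grid s A
  dense-rows⇒grid r s≤2^r xs inc heavy long
    with pigeonholes (suc s) t {Separator} xs (All.map separator heavy)
    where
    -- The bound `c < t` is repeated in the property because `pigeonholes` returns the colours
    -- without it.
    Separator : Fin (suc s) → ℕ → ℕ → Set
    Separator a x c = c < t × T (A x c) × count (A x) c ≡ toℕ a * 2 ^ r
    separator : ∀ {x} → s * 2 ^ r < count (A x) t → ∀ a → ∃ λ c → c < t × Separator a x c
    separator {x} h a =
      -- Numbering starts at 0, so the last separator, number `s * 2 ^ r`, relies on the strict
      -- inequality `h`.
      let c , c<t , rest = nth-hit (A x) (toℕ a * 2 ^ r) t
            (≤-<-trans (*-monoˡ-≤ (2 ^ r) (≤-pred (toℕ<n a))) h)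
      in c , c<t , c<t , rest
  ... | sep , ys , ys⊆ , seps , le = record
    { row = λ b → brow (β b)
    ; col = λ a b → bcol (β b) a
    ; row-inner = λ b → row< (valid b)
    ; row-outer = λ b<b′ → proj₁ (β-inc b<b′)
    ; col-inner = λ a b<b′ → proj₂ (β-inc b<b′) a
    ; col-outer = λ {a} {a′} a<a′ b b′ →
        <-≤-trans (<hi (valid b) a) (≤-trans (hi≤lo (valid b) a<a′) (lo≤ (valid b′) a′))
    ; hit = λ b → hits (valid b)
    }
    where
    open ≤-Reasoning
    lo hi : Fin s → ℕ
    lo = sep ∘ inject₁
    hi = sep ∘ fsuc
    instance
      t^s≢0 : NonZero (t ^ suc s)
      t^s≢0 = m^n≢0 t (suc s)
    dense : ∀ {x} → (∀ a → sep a < t × T (A x (sep a)) × count (A x) (sep a) ≡ toℕ a * 2 ^ r) →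
      Dense lo hi (2 ^ r) x
    dense {x} at a =
      let _ , _ , e = at (inject₁ a)
          hi<t , _ , e′ = at (fsuc a)
      in <⇒≤ hi<t , (begin
        count (A x) (lo a) + 2 ^ r         ≡⟨ cong (_+ 2 ^ r) e ⟩
        toℕ (inject₁ a) * 2 ^ r + 2 ^ r    ≡⟨ cong (λ z → z * 2 ^ r + 2 ^ r) (toℕ-inject₁ a) ⟩
        toℕ a * 2 ^ r + 2 ^ r              ≡⟨ +-comm _ (2 ^ r) ⟩
        suc (toℕ a) * 2 ^ r                ≡⟨ e′ ⟨
        count (A x) (hi a)                 ∎)
    found = batches r {lo} {hi} ys (AllPairs-resp-⊆ ys⊆ inc)
      (All.map dense seps)
      (*-cancelˡ-≤ (t ^ suc s) (≤-trans long le))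
    βs = proj₁ found
    s≤βs : s ≤ length βs
    s≤βs = subst (s ≤_) (sym (proj₁ (proj₂ found))) s≤2^r
    -- The first `s` of the `2 ^ r` batches suffice.
    β : Fin s → Batch s
    β b = lookup βs (inject≤ b s≤βs)
    valid : ∀ b → Valid ys lo hi (β b)
    valid b = All.lookup (proj₂ (proj₂ (proj₂ found))) (∈-lookup (inject≤ b s≤βs))
    β-inc : ∀ {b b′} → b <ᶠ b′ → β b ≺ β b′
    β-inc {b} {b′} b<b′ = AllPairs-lookup (proj₁ (proj₂ (proj₂ found)))
      (subst₂ _<_ (sym (toℕ-inject≤ b s≤βs)) (sym (toℕ-inject≤ b′ s≤βs)) b<b′)
    -- The order of separators is read from the counts in a row that hits them, here the batch's row
    -- in place `a`: `hi a` is separator `a + 1`, and `a + 1 ≤ a′`.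
    hi≤lo : ∀ {β a a′} → Valid ys lo hi β → a <ᶠ a′ → hi a ≤ lo a′
    hi≤lo {β} {a} {a′} v a<a′ =
      let at = All.lookup seps (row∈ v a)
          _ , _ , e = at (fsuc a)
          _ , h , e′ = at (inject₁ a′)
      in count-reflects-≤ (A (brow β a)) h (begin
        count (A (brow β a)) (hi a)    ≡⟨ e ⟩
        suc (toℕ a) * 2 ^ r            ≤⟨ *-monoˡ-≤ (2 ^ r) a<a′ ⟩
        toℕ a′ * 2 ^ r                 ≡⟨ cong (_* 2 ^ r) (toℕ-inject₁ a′) ⟨
        toℕ (inject₁ a′) * 2 ^ r       ≡⟨ e′ ⟨
        count (A (brow β a)) (lo a′)   ∎)

-- Finite sums

∑-mono-≤ : ∀ n {f g} → (∀ i → i < n → f i ≤ g i) → ∑ n f ≤ ∑ n g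
∑-mono-≤ zero    f≤g = z≤n
∑-mono-≤ (suc n) f≤g = +-mono-≤ (∑-mono-≤ n (λ i i<n → f≤g i (m<n⇒m<1+n i<n))) (f≤g n ≤-refl)

∑-cong : ∀ n {f g} → (∀ i → f i ≡ g i) → ∑ n f ≡ ∑ n g
∑-cong zero    f≡g = refl
∑-cong (suc n) f≡g = cong₂ _+_ (∑-cong n f≡g) (f≡g n)

∑-const : ∀ n c → ∑ n (λ _ → c) ≡ n * c
∑-const zero    c = refl
∑-const (suc n) c = trans (cong (_+ c) (∑-const n c)) (+-comm (n * c) c)

∑-bound : ∀ n {f c} → (∀ i → i < n → f i ≤ c) → ∑ n f ≤ n * c
∑-bound n {f} {c} f≤c = subst (∑ n f ≤_) (∑-const n c) (∑-mono-≤ n f≤c)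

∑-+ : ∀ n f g → ∑ n (λ i → f i + g i) ≡ ∑ n f + ∑ n g
∑-+ zero    f g = refl
∑-+ (suc n) f g = trans (cong (_+ (f n + g n)) (∑-+ n f g)) (interchange +-commutativeSemigroup (∑ n f) (∑ n g) (f n) (g n))

∑-*ʳ : ∀ n f c → ∑ n (λ i → f i * c) ≡ ∑ n f * c
∑-*ʳ zero    f c = refl
∑-*ʳ (suc n) f c = trans (cong (_+ f n * c) (∑-*ʳ n f c)) (sym (*-distribʳ-+ c (∑ n f) (f n)))

∑-swap : ∀ m n (f : ℕ → ℕ → ℕ) → ∑ m (λ i → ∑ n (f i)) ≡ ∑ n (λ j → ∑ m (λ i → f i j))
∑-swap zero    n f = sym (trans (∑-const n 0) (*-zeroʳ n))
∑-swap (suc m) n f = trans (cong (_+ ∑ n (f m)) (∑-swap m n f)) (sym (∑-+ n _ (f m)))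

∑-append : ∀ m n f → ∑ (m + n) f ≡ ∑ m f + ∑ n (λ i → f (m + i))
∑-append m zero    f = trans (cong (λ k → ∑ k f) (+-identityʳ m)) (sym (+-identityʳ _))
∑-append m (suc n) f = trans (cong (λ k → ∑ k f) (+-suc m n))
  (trans (cong (_+ f (m + n)) (∑-append m n f)) (+-assoc (∑ m f) _ _))

∑-blocks : ∀ m t f → ∑ (m * t) f ≡ ∑ m (λ i → ∑ t (λ r → f (i * t + r)))
∑-blocks zero    t f = refl
∑-blocks (suc m) t f = trans (cong (λ k → ∑ k f) (+-comm t (m * t)))
  (trans (∑-append (m * t) t f) (cong (_+ ∑ t (λ r → f (m * t + r))) (∑-blocks m t f)))

∑-front : ∀ n f → ∑ (suc n) f ≡ f 0 + ∑ n (f ∘ suc)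
∑-front zero    f = +-comm 0 (f 0)
∑-front (suc n) f = trans (cong (_+ f (suc n)) (∑-front n f)) (+-assoc (f 0) _ _)

sum-allFin : ∀ n (f : ℕ → ℕ) → sum (map (f ∘ toℕ) (allFin n)) ≡ ∑ n f
sum-allFin n f = trans (cong sum (map-tabulate {n = n} (λ i → i) (f ∘ toℕ))) (sum-tabulate n f)
  where
  sum-tabulate : ∀ n (f : ℕ → ℕ) → sum (tabulate {n = n} (f ∘ toℕ)) ≡ ∑ n f
  sum-tabulate zero    f = refl
  sum-tabulate (suc n) f = trans (cong (f 0 +_) (sum-tabulate n (f ∘ suc))) (sym (∑-front n f))

∑∑ : ℕ → (ℕ → ℕ → ℕ) → ℕ
∑∑ n f = ∑ n (λ i → ∑ n (f i))

∑∑-mono-≤ : ∀ n {f g} → (∀ i j → i < n → j < n → f i j ≤ g i j) → ∑∑ n f ≤ ∑∑ n g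
∑∑-mono-≤ n f≤g = ∑-mono-≤ n λ i i<n → ∑-mono-≤ n λ j → f≤g i j i<n

∑∑-+ : ∀ n f g → ∑∑ n (λ i j → f i j + g i j) ≡ ∑∑ n f + ∑∑ n g
∑∑-+ n f g = trans (∑-cong n λ i → ∑-+ n (f i) (g i)) (∑-+ n _ _)

∑∑-*ʳ : ∀ n f c → ∑∑ n (λ i j → f i j * c) ≡ ∑∑ n f * c
∑∑-*ʳ n f c = trans (∑-cong n λ i → ∑-*ʳ n (f i) c) (∑-*ʳ n _ c)

∑∑-blocks : ∀ m t (f : ℕ → ℕ → ℕ) →
  ∑∑ (m * t) f ≡ ∑∑ m (λ i j → ∑∑ t (λ r c → f (i * t + r) (j * t + c)))
∑∑-blocks m t f = trans (∑-blocks m t _) (∑-cong m λ i →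
  trans (∑-cong t λ r → ∑-blocks m t _) (∑-swap t m _))

total : ℕ → (ℕ → ℕ → Bool) → ℕ
total n A = ∑∑ n (λ i j → ⟦ A i j ⟧)

⟦⟧-* : ∀ a b c → (T a → T b × T c) → ⟦ a ⟧ ≤ ⟦ b ⟧ * ⟦ c ⟧
⟦⟧-* false b c imp = z≤n
⟦⟧-* true  b c imp with imp tt
⟦⟧-* true true true imp | _ = ≤-refl

⟦¬T⟧≡0 : ∀ b → ¬ T b → ⟦ b ⟧ ≡ 0
⟦¬T⟧≡0 false _  = refl
⟦¬T⟧≡0 true  ¬b = ⊥-elim (¬b tt)

⟦⟧≤1 : ∀ b → ⟦ b ⟧ ≤ 1
⟦⟧≤1 false = z≤n
⟦⟧≤1 true  = ≤-refl

count≤ : ∀ p n → count p n ≤ n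
count≤ p n = subst (count p n ≤_) (*-identityʳ n) (∑-bound n λ i _ → ⟦⟧≤1 (p i))

total-empty : ∀ n A → (∀ i j → i < n → j < n → ¬ T (A i j)) → total n A ≡ 0
total-empty n A none = n≤0⇒n≡0 (subst (total n A ≤_) (trans (cong (n *_) (*-zeroʳ n)) (*-zeroʳ n))
  (∑-bound n λ i i<n → ∑-bound n λ j j<n → ≤-reflexive (⟦¬T⟧≡0 (A i j) (none i j i<n j<n))))

total≤rectangle : ∀ n A (ρ γ : ℕ → Bool) →
  (∀ i j → i < n → j < n → T (A i j) → T (ρ i) × T (γ j)) → total n A ≤ count ρ n * count γ n
total≤rectangle n A ρ γ covers = begin
  total n A                                ≤⟨ ∑∑-mono-≤ n (λ i j i<n j<n → ⟦⟧-* (A i j) (ρ i) (γ j) (covers i j i<n j<n)) ⟩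
  ∑∑ n (λ i j → ⟦ ρ i ⟧ * ⟦ γ j ⟧)         ≡⟨ ∑-cong n (λ i → ∑-cong n λ j → *-comm ⟦ ρ i ⟧ ⟦ γ j ⟧) ⟩
  ∑∑ n (λ i j → ⟦ γ j ⟧ * ⟦ ρ i ⟧)         ≡⟨ ∑-cong n (λ i → ∑-*ʳ n _ ⟦ ρ i ⟧) ⟩
  ∑ n (λ i → count γ n * ⟦ ρ i ⟧)          ≡⟨ ∑-cong n (λ i → *-comm (count γ n) ⟦ ρ i ⟧) ⟩
  ∑ n (λ i → ⟦ ρ i ⟧ * count γ n)          ≡⟨ ∑-*ʳ n _ (count γ n) ⟩
  count ρ n * count γ n                    ∎
  where open ≤-Reasoning

-- Existence tests, supports, and transport of grids.

somewhere : ℕ → (ℕ → Bool) → Bool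
somewhere n p = ⌊ anyUpTo? (λ i → T? (p i)) n ⌋

somewhere⁺ : ∀ {n} p {i} → i < n → T (p i) → T (somewhere n p)
somewhere⁺ {n} p {i} i<n pi = fromWitness {a? = anyUpTo? (λ i → T? (p i)) n} (i , i<n , pi)

somewhere⁻ : ∀ {n} p → T (somewhere n p) → ∃ λ i → i < n × T (p i)
somewhere⁻ {n} p = toWitness {a? = anyUpTo? (λ i → T? (p i)) n}

-- Turns a count into an increasing list of positions, the form that the pigeonhole arguments take.
support : ∀ p n → ∃ λ xs → AllPairs _<_ xs × All (_< n) xs × All (T ∘ p) xs × length xs ≡ count p n
support p zero = [] , [] , [] , [] , refl
support p (suc n) with support p n
... | xs , inc , xs< , pxs , len with p n in eq
...   | false = xs , inc , All.map m<n⇒m<1+n xs< , pxs , trans len (sym (+-identityʳ _))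
...   | true  = xs ++ [ n ] , AllPairsP.++⁺ inc ([] ∷ []) (All.map (_∷ []) xs<)
              , AllP.++⁺ (All.map m<n⇒m<1+n xs<) (≤-refl ∷ [])
              , AllP.++⁺ pxs (subst T (sym eq) tt ∷ [])
              , trans (length-++ xs) (cong (_+ 1) len)

-- Exchanging `a` and `b` swaps rows with columns, so the pattern is its own transpose; this carries
-- the bound on wide blocks over to tall ones.
Grid-transpose : ∀ {A} → Grid s (flip A) → Grid s A
Grid-transpose g = record
  { row = col g ; col = row g
  ; row-inner = col-inner g ; row-outer = col-outer g
  ; col-inner = row-inner g ; col-outer = row-outer g
  ; hit = λ b a → hit g a b
  }

-- Every row and every column of the grid carries a single hit, so each hit may be lifted on its
-- own; monotonicity of `R` and `Q` for every choice of lifts keeps the order.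
Grid-lift : ∀ {A B : ℕ → ℕ → Bool} (R Q : ℕ → ℕ → Set) →
  (∀ {i j i′ j′} → R i i′ → R j j′ → i < j → i′ < j′) →
  (∀ {i j i′ j′} → Q i i′ → Q j j′ → i < j → i′ < j′) →
  (∀ i j → T (B i j) → ∃₂ λ i′ j′ → R i i′ × Q j j′ × T (A i′ j′)) →
  Grid s B → Grid s A
Grid-lift {A = A} R Q R-mono Q-mono lift g = record
  { row = λ b a → proj₁ (at b a)
  ; col = λ a b → proj₁ (proj₂ (at b a))
  ; row-inner = λ b {a} {a′} a<a′ → R-mono (atR b a) (atR b a′) (row-inner g b a<a′)
  ; row-outer = λ {b} {b′} b<b′ a a′ → R-mono (atR b a) (atR b′ a′) (row-outer g b<b′ a a′)
  ; col-inner = λ a {b} {b′} b<b′ → Q-mono (atQ b a) (atQ b′ a) (col-inner g a b<b′)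
  ; col-outer = λ {a} {a′} a<a′ b b′ → Q-mono (atQ b a) (atQ b′ a′) (col-outer g a<a′ b b′)
  ; hit = λ b a → proj₂ (proj₂ (proj₂ (proj₂ (at b a))))
  }
  where
  at : ∀ b a → ∃₂ λ i′ j′ → R (row g b a) i′ × Q (col g a b) j′ × T (A i′ j′)
  at b a = lift (row g b a) (col g a b) (hit g b a)
  atR : ∀ b a → R (row g b a) (proj₁ (at b a))
  atR b a = proj₁ (proj₂ (proj₂ (at b a)))
  atQ : ∀ b a → Q (col g a b) (proj₁ (proj₂ (at b a)))
  atQ b a = proj₁ (proj₂ (proj₂ (proj₂ (at b a))))

-- Contraction of blocks

InBlock : ℕ → ℕ → ℕ → Set
InBlock t i i′ = ∃ λ r → r < t × i′ ≡ i * t + r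

InBlock-mono : ∀ t {i j i′ j′} → InBlock t i i′ → InBlock t j j′ → i < j → i′ < j′
InBlock-mono t {i} {j} (r , r<t , refl) (r′ , _ , refl) i<j = begin-strict
  i * t + r      <⟨ +-monoʳ-< (i * t) r<t ⟩
  i * t + t      ≡⟨ +-comm (i * t) t ⟩
  suc i * t      ≤⟨ *-monoˡ-≤ t i<j ⟩
  j * t          ≤⟨ m≤m+n (j * t) r′ ⟩
  j * t + r′     ∎
  where open ≤-Reasoning

module _ (t : ℕ) (A : ℕ → ℕ → Bool) where

  -- With `j` first, `columns j` is itself a matrix, having one row for each block in the `j`-th
  -- column of blocks.
  columns : ℕ → ℕ → ℕ → Bool
  columns j i c = somewhere t (λ r → A (i * t + r) (j * t + c))

  contract : ℕ → ℕ → Bool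
  contract i j = somewhere t (columns j i)

  wide : ℕ → ℕ → ℕ → Bool
  wide w j i = w <ᵇ count (columns j i) t

  contract-grid : Grid s contract → Grid s A
  contract-grid = Grid-lift (InBlock t) (InBlock t) (InBlock-mono t) (InBlock-mono t) λ i j h →
    let c , c<t , h′ = somewhere⁻ (columns j i) h
        r , r<t , h″ = somewhere⁻ (λ r → A (i * t + r) (j * t + c)) h′
    in _ , _ , (r , r<t , refl) , (c , c<t , refl) , h″

  columns-grid : ∀ j → Grid s (columns j) → Grid s A
  columns-grid j = Grid-lift (InBlock t) (λ c c′ → c′ ≡ j * t + c) (InBlock-mono t)
    (λ { refl refl → +-monoʳ-< (j * t) }) λ i c h →
    let r , r<t , h′ = somewhere⁻ (λ r → A (i * t + r) (j * t + c)) h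
    in _ , _ , (r , r<t , refl) , refl , h′

  -- The wide blocks in a column of blocks are dense rows of `columns j`; too many of them would
  -- yield a grid there, and by lifting one in `A`.
  few-wide : .{{_ : NonZero t}} → ∀ r → s ≤ 2 ^ r → ¬ Grid s A → ∀ j m →
    count (wide (s * 2 ^ r) j) m ≤ t ^ suc s * ((2 * t ^ s) ^ r * s)
  few-wide {s} r s≤ ¬grid j m = ≮⇒≥ λ many →
    let xs , inc , _ , pxs , len = support (wide (s * 2 ^ r) j) m
    in ¬grid (columns-grid j (dense-rows⇒grid (columns j) t r s≤ xs inc
         (All.map (λ {x} → <ᵇ⇒< (s * 2 ^ r) (count (columns j x) t)) pxs)
         (subst (t ^ suc s * ((2 * t ^ s) ^ r * s) ≤_) (sym len) (<⇒≤ many))))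

  -- An empty block contributes nothing, a block neither wide nor tall has its ones in at most `w`
  -- rows and `w` columns, and any other has at most `t * t` ones. The last test is `wide` for
  -- `flip A`, unfolded.
  block-bound : ∀ w i j → ∑∑ t (λ r c → ⟦ A (i * t + r) (j * t + c) ⟧) ≤
    ⟦ contract i j ⟧ * (w * w) +
    (⟦ wide w j i ⟧ + ⟦ w <ᵇ count (λ r → somewhere t (λ c → A (i * t + r) (j * t + c))) t ⟧) * (t * t)
  block-bound w i j with T? (contract i j)
  ... | no ¬nonempty = subst (_≤ ⟦ contract i j ⟧ * (w * w) + heavy * (t * t))
      (sym (total-empty t p λ r c r<t c<t h → ¬nonempty (somewhere⁺ C c<t (somewhere⁺ (λ r → p r c) r<t h)))) z≤n
    where
    p : ℕ → ℕ → Bool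
    p r c = A (i * t + r) (j * t + c)
    C = columns j i
    heavy = ⟦ wide w j i ⟧ + ⟦ w <ᵇ count (λ r → somewhere t (p r)) t ⟧
  ... | yes nonempty = subst (λ e → total t p ≤ e * (w * w) + heavy * (t * t))
      (sym (⟦T⟧≡1 (contract i j) nonempty))
      (≤-trans
        (total≤rectangle t p R C λ r c r<t c<t h → somewhere⁺ (p r) c<t h , somewhere⁺ (λ r → p r c) r<t h)
        small)
    where
    open ≤-Reasoning
    p : ℕ → ℕ → Bool
    p r c = A (i * t + r) (j * t + c)
    R C : ℕ → Bool
    R r = somewhere t (p r)
    C = columns j i
    heavy = ⟦ wide w j i ⟧ + ⟦ w <ᵇ count R t ⟧
    1≤⟦_⟧ : ∀ {n} → w < n → 1 ≤ ⟦ w <ᵇ n ⟧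
    1≤⟦_⟧ {n} w<n = ≤-reflexive (sym (⟦T⟧≡1 (w <ᵇ n) (<⇒<ᵇ w<n)))
    large : 1 ≤ heavy → count R t * count C t ≤ 1 * (w * w) + heavy * (t * t)
    large 1≤ = begin
      count R t * count C t            ≤⟨ *-mono-≤ (count≤ R t) (count≤ C t) ⟩
      t * t                            ≡⟨ *-identityˡ (t * t) ⟨
      1 * (t * t)                      ≤⟨ *-monoˡ-≤ (t * t) 1≤ ⟩
      heavy * (t * t)                  ≤⟨ m≤n+m _ (1 * (w * w)) ⟩
      1 * (w * w) + heavy * (t * t)    ∎
    small : count R t * count C t ≤ 1 * (w * w) + heavy * (t * t)
    small = case (w <? count C t) of λ where
      (yes w<C) → large (≤-trans 1≤⟦ w<C ⟧ (m≤m+n ⟦ wide w j i ⟧ _))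
      (no w≮C)  → case (w <? count R t) of λ where
        (yes w<R) → large (≤-trans 1≤⟦ w<R ⟧ (m≤n+m _ ⟦ wide w j i ⟧))
        (no w≮R)  → begin
          count R t * count C t            ≤⟨ *-mono-≤ (≮⇒≥ w≮R) (≮⇒≥ w≮C) ⟩
          w * w                            ≡⟨ *-identityˡ (w * w) ⟨
          1 * (w * w)                      ≤⟨ m≤m+n (1 * (w * w)) _ ⟩
          1 * (w * w) + heavy * (t * t)    ∎

contraction-bound : ∀ t w W m A →
  (∀ j → count (wide t A w j) m ≤ W) → (∀ i → count (wide t (flip A) w i) m ≤ W) →
  total (m * t) A ≤ total m (contract t A) * (w * w) + (m * W + m * W) * (t * t)
contraction-bound t w W m A few-wide few-tall = begin
  total (m * t) A
    ≡⟨ ∑∑-blocks m t _ ⟩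
  ∑∑ m (λ i j → ∑∑ t (λ r c → ⟦ A (i * t + r) (j * t + c) ⟧))
    ≤⟨ ∑∑-mono-≤ m (λ i j _ _ → block-bound t A w i j) ⟩
  ∑∑ m (λ i j → ⟦ contract t A i j ⟧ * (w * w) + (Wide i j + Tall i j) * (t * t))
    ≡⟨ ∑∑-+ m _ _ ⟩
  ∑∑ m (λ i j → ⟦ contract t A i j ⟧ * (w * w)) + ∑∑ m (λ i j → (Wide i j + Tall i j) * (t * t))
    ≡⟨ cong₂ _+_ (∑∑-*ʳ m _ (w * w)) (∑∑-*ʳ m _ (t * t)) ⟩
  total m (contract t A) * (w * w) + ∑∑ m (λ i j → Wide i j + Tall i j) * (t * t)
    ≤⟨ +-monoʳ-≤ (total m (contract t A) * (w * w)) (*-monoˡ-≤ (t * t) wide+tall) ⟩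
  total m (contract t A) * (w * w) + (m * W + m * W) * (t * t)
    ∎
  where
  open ≤-Reasoning
  Wide Tall : ℕ → ℕ → ℕ
  Wide i j = ⟦ wide t A w j i ⟧
  Tall i j = ⟦ wide t (flip A) w i j ⟧
  wide+tall : ∑∑ m (λ i j → Wide i j + Tall i j) ≤ m * W + m * W
  wide+tall = begin
    ∑∑ m (λ i j → Wide i j + Tall i j)                ≡⟨ ∑∑-+ m Wide Tall ⟩
    -- Wide blocks are bounded along columns of blocks, so their sum is exchanged; tall blocks are
    -- already summed along rows of blocks.
    ∑∑ m Wide + ∑∑ m Tall                             ≡⟨ cong (_+ ∑∑ m Tall) (∑-swap m m Wide) ⟩
    ∑∑ m (flip Wide) + ∑∑ m Tall                      ≤⟨ +-mono-≤ (∑-bound m (λ j _ → few-wide j)) (∑-bound m (λ i _ → few-tall i)) ⟩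
    m * W + m * W                                     ∎

-- With `m = t ^ e` and `w = s * 2 ^ r`, the contraction contributes at most `K * m * (w * w)` by
-- induction, and the wide and tall blocks at most `K * m`. Since `suc (w * w) ≤ t`, the sum fits
-- into `K * (t * m)`.
total-power : ∀ t .{{_ : NonZero t}} r K → s ≤ 2 ^ r → (s * 2 ^ r) * (s * 2 ^ r) < t → 1 ≤ K →
  (let W = t ^ suc s * ((2 * t ^ s) ^ r * s) in (W + W) * (t * t) ≤ K) →
  ∀ e A → ¬ Grid s A → total (t ^ e) A ≤ K * t ^ e
total-power t r K s≤ w²<t 1≤K W≤K zero A ¬grid =
  ≤-trans (⟦⟧≤1 (A 0 0)) (subst (1 ≤_) (sym (*-identityʳ K)) 1≤K)
total-power {s} t r K s≤ w²<t 1≤K W≤K (suc e) A ¬grid = begin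
  total (t * m) A
    ≡⟨ cong (λ n → total n A) (*-comm t m) ⟩
  total (m * t) A
    ≤⟨ contraction-bound t w W m A (λ j → few-wide t A r s≤ ¬grid j m)
         (λ i → few-wide t (flip A) r s≤ (¬grid ∘ Grid-transpose) i m) ⟩
  total m (contract t A) * (w * w) + (m * W + m * W) * (t * t)
    ≤⟨ +-monoˡ-≤ _ (*-monoˡ-≤ (w * w)
         (total-power t r K s≤ w²<t 1≤K W≤K e (contract t A) (¬grid ∘ contract-grid t A))) ⟩
  K * m * (w * w) + (m * W + m * W) * (t * t)
    ≡⟨ cong (λ x → K * m * (w * w) + x * (t * t)) (*-distribˡ-+ m W W) ⟨
  K * m * (w * w) + m * (W + W) * (t * t)
    ≡⟨ cong (K * m * (w * w) +_) (*-assoc m (W + W) (t * t)) ⟩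
  K * m * (w * w) + m * ((W + W) * (t * t))
    ≤⟨ +-monoʳ-≤ (K * m * (w * w)) (*-monoʳ-≤ m W≤K) ⟩
  K * m * (w * w) + m * K
    ≡⟨ cong (K * m * (w * w) +_) (*-comm m K) ⟩
  K * m * (w * w) + K * m
    ≡⟨ +-comm _ (K * m) ⟩
  K * m + K * m * (w * w)
    ≡⟨ *-suc (K * m) (w * w) ⟨
  K * m * suc (w * w)
    ≤⟨ *-monoʳ-≤ (K * m) w²<t ⟩
  K * m * t
    ≡⟨ *-assoc K m t ⟩
  K * (m * t)
    ≡⟨ cong (K *_) (*-comm m t) ⟩
  K * (t * m)
    ∎
  where
  open ≤-Reasoning
  m = t ^ e
  w = s * 2 ^ r
  W = t ^ suc s * ((2 * t ^ s) ^ r * s)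

-- The exponent is raised only once `n` has reached `t ^ e`, so the new power is at most `t * n`; it
-- is at least `2 * n`, hence at least `suc n`.
power-above : ∀ t → 2 ≤ t → ∀ n → 1 ≤ n → ∃ λ e → n ≤ t ^ e × t ^ e ≤ t * n
power-above t 2≤t 1 _ = 0 , ≤-refl , subst (1 ≤_) (sym (*-identityʳ t)) (<⇒≤ 2≤t)
power-above t 2≤t (suc n@(suc _)) _ with power-above t 2≤t n (s≤s z≤n)
... | e , n≤ , ≤tn with n <? t ^ e
...   | yes n< = e , n< , ≤-trans ≤tn (*-monoʳ-≤ t (n≤1+n n))
...   | no n≮  = suc e
               , (begin
                   suc n       ≤⟨ s≤s (m≤m+n n _) ⟩
                   suc (n + _) ≡⟨ +-suc n _ ⟨
                   2 * n       ≤⟨ *-mono-≤ 2≤t n≤ ⟩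
                   t * t ^ e   ∎)
               , *-monoʳ-≤ t (≤-trans (≮⇒≥ n≮) (n≤1+n n))
  where open ≤-Reasoning

-- From Boolean matrices on Fin n to infinite ones

-- Padding with `false` lets the side be rounded up to a power of `t` without creating ones.
extend : ∀ {n} → Mat n n → ℕ → ℕ → Bool
extend {n} A i j with i <? n | j <? n
... | yes i<n | yes j<n = A (fromℕ< i<n) (fromℕ< j<n)
... | yes _   | no _    = false
... | no _    | _       = false

extend⁻ : ∀ {n} (A : Mat n n) i j → T (extend A i j) →
  Σ (i < n) λ i<n → Σ (j < n) λ j<n → T (A (fromℕ< i<n) (fromℕ< j<n))
extend⁻ {n} A i j h with i <? n | j <? n
... | yes i<n | yes j<n = i<n , j<n , h

extend-toℕ : ∀ {n} (A : Mat n n) i j → extend A (toℕ i) (toℕ j) ≡ A i j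
extend-toℕ {n} A i j with toℕ i <? n | toℕ j <? n
... | yes i<n | yes j<n = cong₂ A (fromℕ<-toℕ i i<n) (fromℕ<-toℕ j j<n)
... | yes _   | no j≮n  = ⊥-elim (j≮n (toℕ<n j))
... | no i≮n  | _       = ⊥-elim (i≮n (toℕ<n i))

ones≡total : ∀ {n} (A : Mat n n) → ones A ≡ total n (extend A)
ones≡total {n} A = trans
  (cong sum (map-cong (λ i → trans
    (cong sum (map-cong (λ j → cong ⟦_⟧ (sym (extend-toℕ A i j))) (allFin n)))
    (sum-allFin n (λ j → ⟦ extend A (toℕ i) j ⟧))) (allFin n)))
  (sum-allFin n (λ i → ∑ n (λ j → ⟦ extend A i j ⟧)))

-- The formula in `G` exchanges the two base-`s` digits `b = r / s` and `a = r % s` of `r`.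
G-combine : ∀ s r c → G s r c ≡ true →
  Σ (Fin s) λ b → Σ (Fin s) λ a → r ≡ combine b a × c ≡ combine a b
G-combine s@(suc _) r c g = b , a
  , toℕ-injective (begin
      toℕ r                          ≡⟨ m≡m%n+[m/n]*n (toℕ r) s ⟩
      toℕ r % s + toℕ r / s * s      ≡⟨ +-comm (toℕ r % s) _ ⟩
      toℕ r / s * s + toℕ r % s      ≡⟨ cong (_+ toℕ r % s) (*-comm (toℕ r / s) s) ⟩
      s * (toℕ r / s) + toℕ r % s    ≡⟨ cong₂ (λ x y → s * x + y) b≡ a≡ ⟨
      s * toℕ b + toℕ a              ≡⟨ toℕ-combine b a ⟨
      toℕ (combine b a)              ∎)
  , toℕ-injective (begin
      toℕ c                          ≡⟨ toWitness {a? = toℕ c ≟ _} (subst T (sym g) tt) ⟩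
      toℕ r / s + toℕ r % s * s      ≡⟨ +-comm (toℕ r / s) _ ⟩
      toℕ r % s * s + toℕ r / s      ≡⟨ cong (_+ toℕ r / s) (*-comm (toℕ r % s) s) ⟩
      s * (toℕ r % s) + toℕ r / s    ≡⟨ cong₂ (λ x y → s * x + y) a≡ b≡ ⟨
      s * toℕ a + toℕ b              ≡⟨ toℕ-combine a b ⟨
      toℕ (combine a b)              ∎)
  where
  open ≡-Reasoning
  r/s<s : toℕ r / s < s
  r/s<s = m<n*o⇒m/o<n (toℕ<n r)
  r%s<s : toℕ r % s < s
  r%s<s = m%n<n (toℕ r) s
  b a : Fin s
  b = fromℕ< r/s<s
  a = fromℕ< r%s<s
  b≡ = toℕ-fromℕ< r/s<s
  a≡ = toℕ-fromℕ< r%s<s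

flatten : (Fin s → Fin s → ℕ) → Fin (s * s) → ℕ
flatten {s} f x = uncurry f (remQuot {s} s x)

flatten-combine : ∀ (f : Fin s → Fin s → ℕ) i j → flatten f (combine i j) ≡ f i j
flatten-combine f i j = cong (uncurry f) (remQuot-combine i j)

-- `combine` orders pairs lexicographically: `outer` settles a difference in the first index,
-- `inner` one in the second.
flatten-mono : ∀ (f : Fin s → Fin s → ℕ) →
  (∀ i {j j′} → j <ᶠ j′ → f i j < f i j′) →
  (∀ {i i′} → i <ᶠ i′ → ∀ j j′ → f i j < f i′ j′) →
  ∀ x y → x <ᶠ y → flatten f x < flatten f y
flatten-mono {s} f inner outer x y x<y =
  on-combine _ _ _ _ (subst₂ _<ᶠ_ (sym (combine-remQuot {s} s x)) (sym (combine-remQuot {s} s y)) x<y)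
  where
  on-combine : ∀ i j i′ j′ → combine i j <ᶠ combine i′ j′ → f i j < f i′ j′
  on-combine i j i′ j′ lt with <ᶠ-cmp i i′
  ... | tri< i<i′ _ _ = outer i<i′ j j′
  ... | tri> _ _ i′<i = ⊥-elim (<-asym lt (combine-monoˡ-< j′ j i′<i))
  ... | tri≈ _ refl _ = inner i (+-cancelˡ-< (s * toℕ i) _ _
          (subst₂ _<_ (toℕ-combine i j) (toℕ-combine i j′) lt))

grid⇒contains : ∀ {n} (A : Mat n n) → Grid s (extend A) → Contains A (G s)
grid⇒contains {s} {n} A g =
    (λ x → fromℕ< (row<n x)) , (λ x → fromℕ< (col<n x))
  , (λ x y x<y → subst₂ _<_ (sym (toℕ-fromℕ< (row<n x))) (sym (toℕ-fromℕ< (row<n y)))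
      (flatten-mono (row g) (row-inner g) (row-outer g) x y x<y))
  , (λ x y x<y → subst₂ _<_ (sym (toℕ-fromℕ< (col<n x))) (sym (toℕ-fromℕ< (col<n y)))
      (flatten-mono (col g) (col-inner g) (col-outer g) x y x<y))
  , on-one
  where
  at : ∀ b a → Σ (row g b a < n) λ r<n → Σ (col g a b < n) λ c<n → T (A (fromℕ< r<n) (fromℕ< c<n))
  at b a = extend⁻ A (row g b a) (col g a b) (hit g b a)
  -- Each row and each column of the grid carries a hit, and a hit of `extend A` certifies that its
  -- indices are below `n`.
  row<n : ∀ x → flatten (row g) x < n
  row<n x = proj₁ (at _ _)
  col<n : ∀ x → flatten (col g) x < n
  col<n x = proj₁ (proj₂ (at _ _))
  on-one : ∀ r c → G s r c ≡ true → A (fromℕ< (row<n r)) (fromℕ< (col<n c)) ≡ true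
  on-one r c one with G-combine s r c one
  ... | b , a , refl , refl = begin
    A (fromℕ< (row<n (combine b a))) (fromℕ< (col<n (combine a b)))
      ≡⟨ cong₂ A (fromℕ<-cong _ _ (flatten-combine (row g) b a) _ _) (fromℕ<-cong _ _ (flatten-combine (col g) a b) _ _) ⟩
    A (fromℕ< (proj₁ (at b a))) (fromℕ< (proj₁ (proj₂ (at b a))))
      ≡⟨ Equivalence.to T-≡ (proj₂ (proj₂ (at b a))) ⟩
    true ∎
    where open ≡-Reasoning

-- The numerical bound

-- Strong induction: `n ≤ 2 * ⌈ n /2⌉`, and halving lowers the logarithm by one.
n≤2^⌈log₂n⌉ : ∀ n → n ≤ 2 ^ ⌈log₂ n ⌉
n≤2^⌈log₂n⌉ = <-rec _ step
  where
  open ≤-Reasoning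
  step : ∀ n → (∀ {m} → m < n → m ≤ 2 ^ ⌈log₂ m ⌉) → n ≤ 2 ^ ⌈log₂ n ⌉
  step 0 _ = z≤n
  step 1 _ = ≤-refl
  step n@(suc (suc k)) rec = begin
    n                            ≡⟨ ⌊n/2⌋+⌈n/2⌉≡n n ⟨
    ⌊ n /2⌋ + ⌈ n /2⌉            ≤⟨ +-mono-≤ (⌊n/2⌋≤⌈n/2⌉ n) (≤-reflexive (sym (+-identityʳ _))) ⟩
    2 * ⌈ n /2⌉                  ≤⟨ *-monoʳ-≤ 2 (rec (⌈n/2⌉<n k)) ⟩
    2 ^ suc ⌈log₂ ⌈ n /2⌉ ⌉      ≡⟨ cong (λ e → 2 ^ suc e) (⌈log₂⌈n/2⌉⌉≡⌈log₂n⌉∸1 n) ⟩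
    2 ^ suc (⌈log₂ n ⌉ ∸ 1)      ≡⟨ cong (2 ^_) (m+[n∸m]≡n (⌈log₂⌉-mono-≤ {2} {n} (s≤s (s≤s z≤n)))) ⟩
    2 ^ ⌈log₂ n ⌉                ∎

-- K t is the leading constant: K bounds 2 W t², and the factor t pays for rounding n up to a power of t.
ones-bound : ∀ s → 2 ≤ s → ∀ {n} (A : Mat n n) → 1 ≤ n → Avoids A (G s) →
  ones A ≤ 2 ^ (33 * s * ⌈log₂ (s * s) ⌉ ^ 2) * n
ones-bound s 2≤s {n} A 1≤n avoids = begin
  ones A                        ≡⟨ ones≡total A ⟩
  total n B                     ≤⟨ ≤-trans (∑-monoˡ-≤ _ n≤t^e) (∑-mono-≤ (t ^ e) (λ i _ → ∑-monoˡ-≤ _ n≤t^e)) ⟩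
  total (t ^ e) B               ≤⟨ total-power t L K s≤2^L w²<t (m^n>0 2 k) W≤K e B (avoids ∘ grid⇒contains A) ⟩
  K * t ^ e                     ≤⟨ *-monoʳ-≤ K t^e≤ ⟩
  K * (t * n)                   ≡⟨ *-assoc K t n ⟨
  K * t * n                     ≡⟨ cong (_* n) (^-distribˡ-+-* 2 k (5 * L)) ⟨
  2 ^ (k + 5 * L) * n           ≤⟨ *-monoˡ-≤ n (^-monoʳ-≤ 2 exponent) ⟩
  2 ^ (33 * s * L ^ 2) * n      ∎
  where
  open ≤-Reasoning
  B = extend A
  L = ⌈log₂ (s * s) ⌉
  -- The width `s * 2 ^ L` is at most `2 ^ (L + L)`, so its square takes four `L` in the exponent;
  -- the fifth makes the inequality with `t` strict.
  t = 2 ^ (5 * L)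
  -- The summands come from `2 * (t * t)`, from `t ^ suc s`, from `(2 * t ^ s) ^ L` and from
  -- `s ≤ 2 ^ L`, in this order.
  k = 1 + 10 * L + (5 * L * suc s + ((1 + 5 * L * s) * L + L))
  K = 2 ^ k
  W = t ^ suc s * ((2 * t ^ s) ^ L * s)
  instance
    t≢0 : NonZero t
    t≢0 = m^n≢0 2 (5 * L)
  1≤s : 1 ≤ s
  1≤s = <⇒≤ 2≤s
  1≤L : 1 ≤ L
  1≤L = ⌈log₂⌉-mono-≤ {2} {s * s} (*-mono-≤ 2≤s 1≤s)
  s≤2^L : s ≤ 2 ^ L
  s≤2^L = ≤-trans (subst (_≤ s * s) (*-identityʳ s) (*-monoʳ-≤ s 1≤s)) (n≤2^⌈log₂n⌉ (s * s))
  w≤ : s * 2 ^ L ≤ 2 ^ (L + L)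
  w≤ = ≤-trans (*-monoˡ-≤ (2 ^ L) s≤2^L) (≤-reflexive (sym (^-distribˡ-+-* 2 L L)))
  w²<t : (s * 2 ^ L) * (s * 2 ^ L) < t
  w²<t = begin-strict
    (s * 2 ^ L) * (s * 2 ^ L)        ≤⟨ *-mono-≤ w≤ w≤ ⟩
    2 ^ (L + L) * 2 ^ (L + L)        ≡⟨ ^-distribˡ-+-* 2 (L + L) (L + L) ⟨
    2 ^ (L + L + (L + L))            <⟨ ^-monoʳ-< 2 ≤-refl (begin-strict
                                          L + L + (L + L)          <⟨ +-monoˡ-≤ _ 1≤L ⟩
                                          L + (L + L + (L + L))    ≡⟨ solve 1 (λ L → L :+ (L :+ L :+ (L :+ L)) := con 5 :* L) refl L ⟩
                                          5 * L                    ∎) ⟩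
    t                                ∎
  2t^s : 2 * t ^ s ≡ 2 ^ (1 + 5 * L * s)
  2t^s = cong (2 *_) (^-*-assoc 2 (5 * L) s)
  W≤ : W ≤ 2 ^ (5 * L * suc s + ((1 + 5 * L * s) * L + L))
  W≤ = begin
    t ^ suc s * ((2 * t ^ s) ^ L * s)
      ≡⟨ cong₂ (λ x y → x * (y * s)) (^-*-assoc 2 (5 * L) (suc s)) (trans (cong (_^ L) 2t^s) (^-*-assoc 2 (1 + 5 * L * s) L)) ⟩
    2 ^ (5 * L * suc s) * (2 ^ ((1 + 5 * L * s) * L) * s)
      ≤⟨ *-monoʳ-≤ (2 ^ (5 * L * suc s)) (*-monoʳ-≤ (2 ^ ((1 + 5 * L * s) * L)) s≤2^L) ⟩
    2 ^ (5 * L * suc s) * (2 ^ ((1 + 5 * L * s) * L) * 2 ^ L)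
      ≡⟨ cong (2 ^ (5 * L * suc s) *_) (^-distribˡ-+-* 2 ((1 + 5 * L * s) * L) L) ⟨
    2 ^ (5 * L * suc s) * 2 ^ ((1 + 5 * L * s) * L + L)
      ≡⟨ ^-distribˡ-+-* 2 (5 * L * suc s) _ ⟨
    2 ^ (5 * L * suc s + ((1 + 5 * L * s) * L + L)) ∎
  W≤K : (W + W) * (t * t) ≤ K
  W≤K = begin
    (W + W) * (t * t)
      ≡⟨ solve 2 (λ W u → (W :+ W) :* u := (con 2 :* u) :* W) refl W (t * t) ⟩
    2 * (t * t) * W
      ≡⟨ cong (λ x → 2 * x * W) (trans (sym (^-distribˡ-+-* 2 (5 * L) (5 * L)))
           (cong (2 ^_) (sym (*-distribʳ-+ L 5 5)))) ⟩
    2 ^ (1 + 10 * L) * W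
      ≤⟨ *-monoʳ-≤ (2 ^ (1 + 10 * L)) W≤ ⟩
    2 ^ (1 + 10 * L) * 2 ^ (5 * L * suc s + ((1 + 5 * L * s) * L + L))
      ≡⟨ ^-distribˡ-+-* 2 (1 + 10 * L) _ ⟨
    K ∎
  -- Lower-order terms are padded with factors 1 so that 1 ≤ s and 1 ≤ L apply termwise.
  exponent : k + 5 * L ≤ 33 * s * L ^ 2
  exponent = begin
    k + 5 * L
      ≡⟨ solve 2 (λ s L → con 1 :+ con 10 :* L :+ (con 5 :* L :* (con 1 :+ s) :+ ((con 1 :+ con 5 :* L :* s) :* L :+ L)) :+ con 5 :* L
           := con 1 :* con 1 :* con 1 :+ con 22 :* (con 1 :* L :* con 1) :+ con 5 :* (s :* L :* con 1) :+ con 5 :* (s :* L :* L)) refl s L ⟩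
    -- The coefficients add up to the constant: 1 + 22 + 5 + 5 = 33.
    1 * 1 * 1 + 22 * (1 * L * 1) + 5 * (s * L * 1) + 5 * (s * L * L)
      ≤⟨ +-monoˡ-≤ _ (+-mono-≤ (+-mono-≤
           (*-mono-≤ (*-mono-≤ 1≤s 1≤L) 1≤L)
           (*-monoʳ-≤ 22 (*-mono-≤ (*-monoˡ-≤ L 1≤s) 1≤L)))
           (*-monoʳ-≤ 5 (*-monoʳ-≤ (s * L) 1≤L))) ⟩
    s * L * L + 22 * (s * L * L) + 5 * (s * L * L) + 5 * (s * L * L)
      ≡⟨ solve 2 (λ s L → s :* L :* L :+ con 22 :* (s :* L :* L) :+ con 5 :* (s :* L :* L) :+ con 5 :* (s :* L :* L)
           := con 33 :* s :* (L :* (L :* con 1))) refl s L ⟩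
    33 * s * L ^ 2 ∎
  above : ∃ λ e → n ≤ t ^ e × t ^ e ≤ t * n
  above = power-above t (^-monoʳ-≤ 2 (≤-trans 1≤L (m≤m+n L _))) n 1≤n
  e = proj₁ above
  n≤t^e = proj₁ (proj₂ above)
  t^e≤ = proj₂ (proj₂ above)

-- The pattern of order one, and the asymptotic bound.

Grid-1 : ∀ {A i j} → T (A i j) → Grid 1 A
Grid-1 {i = i} {j} Aij = record
  { row = λ _ _ → i ; col = λ _ _ → j
  ; row-inner = λ { _ {fzero} {fzero} () } ; row-outer = λ { {fzero} {fzero} () }
  ; col-inner = λ { _ {fzero} {fzero} () } ; col-outer = λ { {fzero} {fzero} () }
  ; hit = λ _ _ → Aij
  }

-- For s = 1 the exponent is 0, so this case needs the separate observation that A has no ones.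
ones≤ : ∀ s → 1 ≤ s → ∀ {n} (A : Mat n n) → 1 ≤ n → Avoids A (G s) →
  ones A ≤ 2 ^ (33 * s * ⌈log₂ (s * s) ⌉ ^ 2) * n
ones≤ 1 _ {n} A _ avoids = subst (_≤ _)
  (sym (trans (ones≡total A) (total-empty n (extend A) λ i j _ _ h →
    avoids (grid⇒contains A (Grid-1 h))))) z≤n
ones≤ s@(suc (suc _)) _ A = ones-bound s (s≤s (s≤s z≤n)) A

-- A limit is at most `E` exactly when, for every `d`, the ratio is eventually at most `E + 1 / d`;
-- this is stated after multiplication by `d * n`. Rounding the logarithm up only changes `C`: at
-- `k = 1` both logarithms vanish, and for `k ≥ 4` they differ by a factor of at most 2.
theorem1p3 : Σ ℕ λ C → ∀ (s : ℕ) → 1 ≤ s → ∀ (d : ℕ) → 1 ≤ d →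
    Σ ℕ λ N → ∀ (n : ℕ) → N ≤ n → ∀ (A : Mat n n) → Avoids A (G s) →
    d * ones A ≤ (d * 2 ^ (C * s * (⌈log₂ (s * s) ⌉ ^ 2)) + 1) * n
-- The bound holds from `n = 1` on, which is where rounding up to a power of `t` starts to work.
theorem1p3 = 33 , λ s 1≤s d _ → 1 , λ n 1≤n A avoids →
  let E = 2 ^ (33 * s * ⌈log₂ (s * s) ⌉ ^ 2)
      open ≤-Reasoning
  in begin
    d * ones A       ≤⟨ *-monoʳ-≤ d (ones≤ s 1≤s A 1≤n avoids) ⟩
    d * (E * n)      ≡⟨ *-assoc d E n ⟨
    d * E * n        ≤⟨ *-monoˡ-≤ n (m≤m+n (d * E) 1) ⟩
    (d * E + 1) * n  ∎
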